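{- Let $G$ be an undirected multi-graph with a designated source $s$ and a designated sink $t$, and let $\lambda$ be the capacity of an $(s,t)$-mincut in $G$. Let $f$ be any maximum $(s,t)$-flow in $G$. Then an $(s,t)$-cut $C$ in $G$ has capacity $\lambda+1$ if and only if there exists exactly one edge $e\in E(C)$ such that (1) $f(e)=0$, and (2) for every edge $e'\in E(C)\setminus\{e\}$, $f(e')=1$ and $e'$ carries flow in the direction from $C$ to $\overline{C}$.
   Context: A multi-graph is an unweighted graph (each edge has capacity 1) with parallel edges allowed. An $(s,t)$-cut is a set $C\subset V$ with $s\in C$, $t\in\overline{C}=V\setminus C$. $E(C)$ is the set of edges with exactly one endpoint in $C$; the capacity of $C$ is $|E(C)|$. An $(s,t)$-mincut is an $(s,t)$-cut of minimum capacity. Flows are integral: each undirected edge carries $0$ or $1$ unit of flow, in at most one of its two directions, and $f(e)$ denotes the amount. -}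

module Defs where

open import Data.Bool.Base using (false; _xor_)
open import Data.Fin.Base using (Fin)
open import Data.Fin.Properties using (_≟_)
open import Data.Fin.Subset using (Subset; _∈_; _∉_; ∣_∣)
open import Data.Integer.Base as ℤ using (ℤ; _⊖_)
open import Data.Maybe.Base using (Maybe; just; nothing; maybe′)
open import Data.Nat.Base using (ℕ; _≤_)
open import Data.Product.Base using (_×_; _,_; proj₁; proj₂; swap; ∃₂)
open import Data.Vec.Base using (lookup; tabulate)
open import Relation.Binary.PropositionalEquality.Core using (_≡_; _≢_)
open import Relation.Nullary.Decidable.Core using (⌊_⌋)

-- Edges are named, so parallel edges are distinct elements of Edge.  The order
-- of the two endpoints has no meaning beyond giving names to the two directions
-- of an edge.  Loops are not excluded; they never cross a cut and never
-- contribute to a net flow.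
record Multigraph : Set where
  field
    #vertices : ℕ
    #edges    : ℕ

  Vertex : Set
  Vertex = Fin #vertices

  Edge : Set
  Edge = Fin #edges

  field
    endpoints : Edge → Vertex × Vertex

data EdgeFlow : Set where
  idle forward backward : EdgeFlow

amount : EdgeFlow → ℕ
amount idle     = 0
amount forward  = 1
amount backward = 1

-- The (tail , head) pair along which an edge carries its unit, if any.
along : {V : Set} → EdgeFlow → V × V → Maybe (V × V)
along idle     _ = nothing
along forward  p = just p
along backward p = just (swap p)

module _ (G : Multigraph) where
  open Multigraph G

  VertexSet : Set
  VertexSet = Subset #vertices

  EdgeSet : Set
  EdgeSet = Subset #edges

  IsCut : Vertex → Vertex → VertexSet → Set
  IsCut s t C = s ∈ C × t ∉ C

  E : VertexSet → EdgeSet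
  E C = tabulate λ e →
    lookup C (proj₁ (endpoints e)) xor lookup C (proj₂ (endpoints e))

  capacity : VertexSet → ℕ
  capacity C = ∣ E C ∣

  IsMinCut : Vertex → Vertex → VertexSet → Set
  IsMinCut s t C = IsCut s t C × (∀ D → IsCut s t D → capacity C ≤ capacity D)

  Assignment : Set
  Assignment = Edge → EdgeFlow

  arc : Assignment → Edge → Maybe (Vertex × Vertex)
  arc f e = along (f e) (endpoints e)

  -- Every non-idle edge carries one unit, so flow is measured by counting edges.
  outflow inflow : Assignment → Vertex → ℕ
  outflow f v = ∣ tabulate (λ e → maybe′ (λ a → ⌊ proj₁ a ≟ v ⌋) false (arc f e)) ∣
  inflow  f v = ∣ tabulate (λ e → maybe′ (λ a → ⌊ proj₂ a ≟ v ⌋) false (arc f e)) ∣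

  IsFlow : Vertex → Vertex → Assignment → Set
  IsFlow s t f = ∀ v → v ≢ s → v ≢ t → inflow f v ≡ outflow f v

  value : Vertex → Assignment → ℤ
  value s f = outflow f s ⊖ inflow f s

  IsMaxFlow : Vertex → Vertex → Assignment → Set
  IsMaxFlow s t f = IsFlow s t f × (∀ g → IsFlow s t g → value s g ℤ.≤ value s f)

  CarriesOutOf : Assignment → VertexSet → Edge → Set
  CarriesOutOf f C e = ∃₂ λ x y → arc f e ≡ just (x , y) × x ∈ C × y ∉ C

{-# OPTIONS --safe #-}

-- Call the slack of an edge across a cut 0, 1 or 2 according to whether it
-- carries its unit out of the cut, is idle, or carries its unit into the cut.
-- Conservation gives capacity = value + total slack for every cut.  If the
-- flow is maximum, the vertices reachable from s in the residual graph form a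
-- cut without slack, so the value is the mincut capacity k, and a cut has
-- capacity k + 1 exactly when its total slack is 1, i.e. when one edge is idle
-- and all the others carry flow outwards.
module Submission where

open import Defs
open import Algebra.Bundles using (CommutativeMonoid)
import Algebra.Properties.CommutativeMonoid.Sum as Sum
import Algebra.Properties.Semiring.Sum as SemiringSum
open import Data.Bool.Base using (Bool; true; false; _xor_)
open import Data.Fin.Base using (Fin; zero; suc)
open import Data.Fin.Properties using (_≟_; any?; punchInᵢ≢i)
open import Data.Fin.Subset using (Subset; _∈_; _∉_; _∪_; ⁅_⁆; ∣_∣; _⊃_)
open import Data.Fin.Subset.Induction using (⊃-wellFounded)
open import Data.Fin.Subset.Properties
  using (p⊆p∪q; q⊆p∪q; x∈p∪q⁻; x∈⁅x⁆; x∈⁅y⁆⇒x≡y)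
open import Data.Integer.Base as ℤ using (ℤ; +_; _⊖_; 0ℤ; 1ℤ; -1ℤ)
import Data.Integer.Properties as ℤ
open import Data.Integer.Tactic.RingSolver using (solve-∀)
open import Data.Maybe.Base using (just; maybe′)
open import Data.Nat.Base using (ℕ; zero; suc; _+_)
import Data.Nat.Properties as ℕ
open import Data.Product using (_×_; _,_; proj₁; proj₂; ∃; ∃₂; ∃!)
open import Data.Sum.Base using (_⊎_; inj₁; inj₂)
open import Data.Vec.Base using (lookup; tabulate)
open import Data.Vec.Functional using (Vector; updateAt)
open import Data.Vec.Functional.Properties using (updateAt-updates; updateAt-minimal)
open import Data.Vec.Properties using ([]=⇒lookup; lookup⇒[]=; lookup∘tabulate)
open import Function.Base using (_∘_; const)
open import Function.Bundles using (_⇔_; mk⇔; Equivalence)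
open import Induction.WellFounded using (Acc; acc)
open import Relation.Binary.PropositionalEquality
open import Relation.Nullary using (¬_; yes; no; contradiction)
open import Relation.Nullary.Decidable using (⌊_⌋; ¬?; decidable-stable)

-- Finite sums that differ, or are nonzero, in one place

module _ {c ℓ} (M : CommutativeMonoid c ℓ) where
  open CommutativeMonoid M
    renaming (trans to ≈-trans; sym to ≈-sym)
  open Sum M using (sum; sum-remove; sum-cong-≋; sum-replicate-zero)

  -- `sum-remove` splits off entry `i` from both sums, and what remains agrees termwise. It serves
  -- both to change a flow on one edge and, starting from the zero vector, to evaluate sums with one
  -- nontrivial term.
  sum-bump : ∀ {n} (t t′ : Vector Carrier n) (i : Fin n) {x} →
    t′ i ≈ t i ∙ x → (∀ j → j ≢ i → t′ j ≈ t j) → sum t′ ≈ sum t ∙ x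
  sum-bump {suc n} t t′ i {x} at off =
    ≈-trans (sum-remove {i = i} t′)
    (≈-trans (∙-cong (≈-trans at (comm (t i) x)) (sum-cong-≋ λ j → off _ (punchInᵢ≢i i j)))
    (≈-trans (assoc x (t i) _)
    (≈-trans (∙-congˡ (≈-sym (sum-remove {i = i} t)))
    (comm x (sum t)))))

  sum-single : ∀ {n} (t : Vector Carrier n) (i : Fin n) →
    (∀ j → j ≢ i → t j ≈ ε) → sum t ≈ t i
  sum-single {n} t i off =
    ≈-trans (sum-bump (λ _ → ε) t i (≈-sym (identityˡ (t i))) off)
    (≈-trans (∙-congʳ (sum-replicate-zero n)) (identityˡ (t i)))

open SemiringSum ℤ.+-*-semiring
  using (sum; sum-cong-≗; ∑-distrib-+; ∑-comm; *-distribˡ-sum)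
open Sum ℕ.+-0-commutativeMonoid using () renaming (sum to sumℕ)

+-sumℕ : ∀ {n} (t : Vector ℕ n) → + sumℕ t ≡ sum (+_ ∘ t)
+-sumℕ {zero}  t = refl
+-sumℕ {suc n} t = cong (ℤ._+_ (+ t zero)) (+-sumℕ (t ∘ suc))

sumℕ-zero : ∀ {n} (t : Vector ℕ n) → (∀ i → t i ≡ 0) → sumℕ t ≡ 0
sumℕ-zero {zero}  t t≡0 = refl
sumℕ-zero {suc n} t t≡0 = cong₂ _+_ (t≡0 zero) (sumℕ-zero (t ∘ suc) (t≡0 ∘ suc))

sumℕ≡0⇒≡0 : ∀ {n} (t : Vector ℕ n) → sumℕ t ≡ 0 → ∀ i → t i ≡ 0
sumℕ≡0⇒≡0 t eq zero    = ℕ.m+n≡0⇒m≡0 (t zero) eq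
sumℕ≡0⇒≡0 t eq (suc i) = sumℕ≡0⇒≡0 (t ∘ suc) (ℕ.m+n≡0⇒n≡0 (t zero) eq) i

-- Natural summands cannot cancel, so a total of 1 sits in one place. For this reason slacks are
-- summed in `ℕ`, although flows are summed in `ℤ`.
sumℕ≡1⇒single : ∀ {n} (t : Vector ℕ n) → sumℕ t ≡ 1 →
  ∃ λ i → t i ≡ 1 × (∀ j → j ≢ i → t j ≡ 0)
sumℕ≡1⇒single {suc n} t eq with t zero in t₀
... | suc zero = zero , t₀ , λ where
  zero    0≢0 → contradiction refl 0≢0
  (suc j) _   → sumℕ≡0⇒≡0 (t ∘ suc) (ℕ.suc-injective eq) j
... | zero = let i , tᵢ , off = sumℕ≡1⇒single (t ∘ suc) eq in
  suc i , tᵢ , λ where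
    zero    _  → t₀
    (suc j) ne → off j (ne ∘ cong suc)

-- Cardinalities as integer sums of indicators

ι : Bool → ℤ
ι true  = 1ℤ
ι false = 0ℤ

∣tabulate∣ : ∀ {n} (p : Fin n → Bool) → + ∣ tabulate p ∣ ≡ sum (ι ∘ p)
∣tabulate∣ {zero}  p = refl
∣tabulate∣ {suc n} p with p zero
... | true  = cong (ℤ._+_ 1ℤ) (∣tabulate∣ (p ∘ suc))
... | false = trans (∣tabulate∣ (p ∘ suc)) (sym (ℤ.+-identityˡ _))

∣tabulate∣-⊖ : ∀ {n} (p q : Fin n → Bool) →
  ∣ tabulate p ∣ ⊖ ∣ tabulate q ∣ ≡ sum (λ i → ι (p i) ℤ.- ι (q i))
∣tabulate∣-⊖ p q = begin
  ∣ tabulate p ∣ ⊖ ∣ tabulate q ∣       ≡⟨ ℤ.m-n≡m⊖n ∣ tabulate p ∣ ∣ tabulate q ∣ ⟨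
  + ∣ tabulate p ∣ ℤ.- + ∣ tabulate q ∣ ≡⟨ cong₂ ℤ._-_ (∣tabulate∣ p) (∣tabulate∣ q) ⟩
  sum (ι ∘ p) ℤ.- Q                     ≡⟨ cong (ℤ._- Q) (sum-cong-≗ λ i → split (ι (p i)) (ι (q i))) ⟩
  sum (λ i → d i ℤ.+ ι (q i)) ℤ.- Q     ≡⟨ cong (ℤ._- Q) (∑-distrib-+ d (ι ∘ q)) ⟩
  (sum d ℤ.+ Q) ℤ.- Q                   ≡⟨ cancel (sum d) Q ⟩
  sum d                                 ∎
  where
  open ≡-Reasoning
  d : Fin _ → ℤ
  d i = ι (p i) ℤ.- ι (q i)
  Q = sum (ι ∘ q)
  split : ∀ a b → a ≡ (a ℤ.- b) ℤ.+ b
  split = solve-∀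
  cancel : ∀ a b → (a ℤ.+ b) ℤ.- b ≡ a
  cancel = solve-∀

δ : ∀ {n} → Fin n → Fin n → ℤ
δ a w = ι ⌊ a ≟ w ⌋

δ-refl : ∀ {n} (a : Fin n) → δ a a ≡ 1ℤ
δ-refl a with a ≟ a
... | yes _ = refl
... | no ne = contradiction refl ne

δ-≢ : ∀ {n} {a w : Fin n} → a ≢ w → δ a w ≡ 0ℤ
δ-≢ {a = a} {w} ne with a ≟ w
... | yes eq = contradiction eq ne
... | no _   = refl

∑-δ : ∀ {n} (φ : Fin n → ℤ) (a : Fin n) → sum (λ w → φ w ℤ.* δ a w) ≡ φ a
∑-δ φ a = trans
  (sum-single ℤ.+-0-commutativeMonoid _ a λ w w≢a →
    trans (cong (φ w ℤ.*_) (δ-≢ (w≢a ∘ sym))) (ℤ.*-zeroʳ (φ w)))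
  (trans (cong (φ a ℤ.*_) (δ-refl a)) (ℤ.*-identityʳ (φ a)))

lookup⇒∈ : ∀ {n} (p : Subset n) {i} → lookup p i ≡ true → i ∈ p
lookup⇒∈ p = lookup⇒[]= _ p

∉⇒lookup : ∀ {n} (p : Subset n) {i} → i ∉ p → lookup p i ≡ false
∉⇒lookup p {i} i∉p with lookup p i in eq
... | true  = contradiction (lookup⇒∈ p eq) i∉p
... | false = refl

lookup⇒∉ : ∀ {n} {p : Subset n} {i} → lookup p i ≡ false → i ∉ p
lookup⇒∉ eq i∈p with () ← trans (sym eq) ([]=⇒lookup i∈p)

-- Flow and slack of a single edge

sign : EdgeFlow → ℤ
sign idle     = 0ℤ
sign forward  = 1ℤ
sign backward = -1ℤ

-- Signed flow times potential difference. If `φ` is the indicator of a vertex, this is the edge's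
-- contribution to the net outflow there; if `φ` is the indicator of a cut, its contribution to the
-- net flow out of the cut.
drop : ∀ {V : Set} → (V → ℤ) → EdgeFlow → V × V → ℤ
drop φ x (u , v) = sign x ℤ.* (φ u ℤ.- φ v)

-- The last two arguments say whether the first and the second endpoint lie in
-- the cut.
slack : EdgeFlow → Bool → Bool → ℕ
slack _        true  true  = 0
slack _        false false = 0
slack idle     true  false = 1
slack idle     false true  = 1
slack forward  true  false = 0
slack forward  false true  = 2
slack backward true  false = 2
slack backward false true  = 0

-- The edgewise form of capacity = flow + slack: the slack of a crossing edge is 1 minus its net
-- flow outwards, which is where the values 0, 1 and 2 come from.
xor≡drop+slack : ∀ x a b → ι (a xor b) ≡ sign x ℤ.* (ι a ℤ.- ι b) ℤ.+ + slack x a b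
xor≡drop+slack idle     true  true  = refl
xor≡drop+slack idle     true  false = refl
xor≡drop+slack idle     false true  = refl
xor≡drop+slack idle     false false = refl
xor≡drop+slack forward  true  true  = refl
xor≡drop+slack forward  true  false = refl
xor≡drop+slack forward  false true  = refl
xor≡drop+slack forward  false false = refl
xor≡drop+slack backward true  true  = refl
xor≡drop+slack backward true  false = refl
xor≡drop+slack backward false true  = refl
xor≡drop+slack backward false false = refl

-- A unit carried across the cut gives slack 0 or 2 and a non-crossing edge gives 0, so 1 is left
-- only for idle crossing edges.
slack≡1⇒idle : ∀ x a b → slack x a b ≡ 1 → a xor b ≡ true × amount x ≡ 0
slack≡1⇒idle idle     true  false _ = refl , refl
slack≡1⇒idle idle     false true  _ = refl , refl
slack≡1⇒idle forward  true  false ()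
slack≡1⇒idle forward  false true  ()
slack≡1⇒idle backward true  false ()
slack≡1⇒idle backward false true  ()

idle⇒slack≡1 : ∀ x a b → a xor b ≡ true → amount x ≡ 0 → slack x a b ≡ 1
idle⇒slack≡1 idle true  false _ _ = refl
idle⇒slack≡1 idle false true  _ _ = refl

¬xor⇒slack≡0 : ∀ x a b → a xor b ≡ false → slack x a b ≡ 0
¬xor⇒slack≡0 x true  true  _ = refl
¬xor⇒slack≡0 x false false _ = refl

module _ {n : ℕ} (C : Subset n) where

  slackAcross : EdgeFlow → Fin n × Fin n → ℕ
  slackAcross x p = slack x (lookup C (proj₁ p)) (lookup C (proj₂ p))

  carriesOut⇒slack≡0 : ∀ x p {u v} →
    along x p ≡ just (u , v) → u ∈ C → v ∉ C → slackAcross x p ≡ 0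
  carriesOut⇒slack≡0 forward p refl u∈C v∉C
    rewrite []=⇒lookup u∈C | ∉⇒lookup C v∉C = refl
  carriesOut⇒slack≡0 backward p refl u∈C v∉C
    rewrite []=⇒lookup u∈C | ∉⇒lookup C v∉C = refl

  slack≡0⇒carriesOut : ∀ x p → lookup C (proj₁ p) xor lookup C (proj₂ p) ≡ true →
    slackAcross x p ≡ 0 →
    amount x ≡ 1 × ∃₂ λ u v → along x p ≡ just (u , v) × u ∈ C × v ∉ C
  slack≡0⇒carriesOut x (u , v) crosses full
    with lookup C u in inU | lookup C v in inV
  slack≡0⇒carriesOut forward (u , v) _ _ | true | false =
    refl , u , v , refl , lookup⇒∈ C inU , lookup⇒∉ inV
  slack≡0⇒carriesOut backward (u , v) _ _ | false | true =
    refl , v , u , refl , lookup⇒∈ C inV , lookup⇒∉ inU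

  -- Pushing one more unit from u to v turns the flow of the edge from x to x′.
  residual : ∀ x p → slackAcross x p ≢ 0 →
    ∃ λ x′ → ∃₂ λ u v → u ∈ C × v ∉ C × (p ≡ (u , v) ⊎ p ≡ (v , u)) ×
      (∀ φ → drop φ x′ p ≡ drop φ x p ℤ.+ (φ u ℤ.- φ v))
  residual x (u , v) slack≢0 with lookup C u in inU | lookup C v in inV
  residual x (u , v) slack≢0 | true  | true  = contradiction refl slack≢0
  residual x (u , v) slack≢0 | false | false = contradiction refl slack≢0
  residual forward  (u , v) slack≢0 | true  | false = contradiction refl slack≢0
  residual backward (u , v) slack≢0 | false | true  = contradiction refl slack≢0
  residual idle (u , v) _ | true | false =
    forward , u , v , lookup⇒∈ C inU , lookup⇒∉ inV , inj₁ refl , λ φ → eq (φ u) (φ v)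
    where
    eq : ∀ a b → 1ℤ ℤ.* (a ℤ.- b) ≡ 0ℤ ℤ.* (a ℤ.- b) ℤ.+ (a ℤ.- b)
    eq = solve-∀
  residual backward (u , v) _ | true | false =
    idle , u , v , lookup⇒∈ C inU , lookup⇒∉ inV , inj₁ refl , λ φ → eq (φ u) (φ v)
    where
    eq : ∀ a b → 0ℤ ℤ.* (a ℤ.- b) ≡ -1ℤ ℤ.* (a ℤ.- b) ℤ.+ (a ℤ.- b)
    eq = solve-∀
  residual idle (u , v) _ | false | true =
    backward , v , u , lookup⇒∈ C inV , lookup⇒∉ inU , inj₂ refl , λ φ → eq (φ u) (φ v)
    where
    eq : ∀ a b → -1ℤ ℤ.* (a ℤ.- b) ≡ 0ℤ ℤ.* (a ℤ.- b) ℤ.+ (b ℤ.- a)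
    eq = solve-∀
  residual forward (u , v) _ | false | true =
    idle , v , u , lookup⇒∈ C inV , lookup⇒∉ inU , inj₂ refl , λ φ → eq (φ u) (φ v)
    where
    eq : ∀ a b → 0ℤ ℤ.* (a ℤ.- b) ≡ 1ℤ ℤ.* (a ℤ.- b) ℤ.+ (b ℤ.- a)
    eq = solve-∀

-- Net flow, conservation and the capacity of a cut

module _ (G : Multigraph) where
  open Multigraph G

  crosses : VertexSet G → Edge → Bool
  crosses C e = lookup C (proj₁ (endpoints e)) xor lookup C (proj₂ (endpoints e))

  ∈E⇒crosses : ∀ C e → e ∈ E G C → crosses C e ≡ true
  ∈E⇒crosses C e e∈E = trans (sym (lookup∘tabulate (crosses C) e)) ([]=⇒lookup e∈E)

  crosses⇒∈E : ∀ C e → crosses C e ≡ true → e ∈ E G C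
  crosses⇒∈E C e eq = lookup⇒∈ (E G C) (trans (lookup∘tabulate (crosses C) e) eq)

  net : Assignment G → Vertex → ℤ
  net f w = sum λ e → drop (λ a → δ a w) (f e) (endpoints e)

  outflow⊖inflow : ∀ f w → outflow G f w ⊖ inflow G f w ≡ net f w
  outflow⊖inflow f w = trans
    (∣tabulate∣-⊖ (λ e → maybe′ (λ a → ⌊ proj₁ a ≟ w ⌋) false (arc G f e))
                  (λ e → maybe′ (λ a → ⌊ proj₂ a ≟ w ⌋) false (arc G f e)))
    (sum-cong-≗ λ e → edge (f e) (endpoints e))
    where
    pos : ∀ a b → a ℤ.- b ≡ 1ℤ ℤ.* (a ℤ.- b)
    pos = solve-∀
    neg : ∀ a b → b ℤ.- a ≡ -1ℤ ℤ.* (a ℤ.- b)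
    neg = solve-∀
    edge : ∀ x p →
      ι (maybe′ (λ a → ⌊ proj₁ a ≟ w ⌋) false (along x p)) ℤ.-
      ι (maybe′ (λ a → ⌊ proj₂ a ≟ w ⌋) false (along x p)) ≡ drop (λ a → δ a w) x p
    edge idle     (u , v) = refl
    edge forward  (u , v) = pos (δ u w) (δ v w)
    edge backward (u , v) = neg (δ u w) (δ v w)

  flow⇒net≡0 : ∀ {s t} f → IsFlow G s t f → ∀ v → v ≢ s → v ≢ t → net f v ≡ 0ℤ
  flow⇒net≡0 f flow v v≢s v≢t = begin
    net f v                       ≡⟨ outflow⊖inflow f v ⟨
    outflow G f v ⊖ inflow G f v  ≡⟨ cong (outflow G f v ⊖_) (flow v v≢s v≢t) ⟩
    outflow G f v ⊖ outflow G f v ≡⟨ ℤ.n⊖n≡0 (outflow G f v) ⟩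
    0ℤ                            ∎
    where open ≡-Reasoning

  net≡0⇒flow : ∀ {s t} f → (∀ v → v ≢ s → v ≢ t → net f v ≡ 0ℤ) → IsFlow G s t f
  net≡0⇒flow f net≡0 v v≢s v≢t = sym (ℤ.+-injective (ℤ.i-j≡0⇒i≡j _ _
    (trans (ℤ.m-n≡m⊖n (outflow G f v) (inflow G f v))
    (trans (outflow⊖inflow f v) (net≡0 v v≢s v≢t)))))

  -- Discrete summation by parts: each `φ u` is expanded as a sum of `φ w` against `δ u w`, and the
  -- sums over edges and vertices are exchanged.
  ∑-drop : ∀ φ f → sum (λ e → drop φ (f e) (endpoints e)) ≡ sum (λ w → φ w ℤ.* net f w)
  ∑-drop φ f = begin
    sum (λ e → drop φ (f e) (endpoints e))
      ≡⟨ sum-cong-≗ (λ e → expand (f e) (endpoints e)) ⟩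
    sum (λ e → sum λ w → φ w ℤ.* d w e)
      ≡⟨ ∑-comm (λ e w → φ w ℤ.* d w e) ⟩
    sum (λ w → sum λ e → φ w ℤ.* d w e)
      ≡⟨ sum-cong-≗ (λ w → *-distribˡ-sum (φ w) (d w)) ⟨
    sum (λ w → φ w ℤ.* net f w) ∎
    where
    open ≡-Reasoning
    d : Vertex → Edge → ℤ
    d w e = drop (λ a → δ a w) (f e) (endpoints e)
    distrib : ∀ σ c a b → σ ℤ.* (c ℤ.* a) ℤ.+ (ℤ.- σ) ℤ.* (c ℤ.* b) ≡ c ℤ.* (σ ℤ.* (a ℤ.- b))
    distrib = solve-∀
    factor : ∀ σ a b → σ ℤ.* (a ℤ.- b) ≡ σ ℤ.* a ℤ.+ (ℤ.- σ) ℤ.* b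
    factor = solve-∀
    scaled-δ : ∀ σ u → σ ℤ.* φ u ≡ sum (λ w → σ ℤ.* (φ w ℤ.* δ u w))
    scaled-δ σ u = trans (cong (σ ℤ.*_) (sym (∑-δ φ u))) (*-distribˡ-sum σ (λ w → φ w ℤ.* δ u w))
    expand : ∀ x p → drop φ x p ≡ sum (λ w → φ w ℤ.* drop (λ a → δ a w) x p)
    expand x (u , v) = begin
      σ ℤ.* (φ u ℤ.- φ v)
        ≡⟨ factor σ (φ u) (φ v) ⟩
      σ ℤ.* φ u ℤ.+ (ℤ.- σ) ℤ.* φ v
        ≡⟨ cong₂ ℤ._+_ (scaled-δ σ u) (scaled-δ (ℤ.- σ) v) ⟩
      sum (λ w → σ ℤ.* (φ w ℤ.* δ u w)) ℤ.+ sum (λ w → (ℤ.- σ) ℤ.* (φ w ℤ.* δ v w))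
        ≡⟨ ∑-distrib-+ (λ w → σ ℤ.* (φ w ℤ.* δ u w)) (λ w → (ℤ.- σ) ℤ.* (φ w ℤ.* δ v w)) ⟨
      sum (λ w → σ ℤ.* (φ w ℤ.* δ u w) ℤ.+ (ℤ.- σ) ℤ.* (φ w ℤ.* δ v w))
        ≡⟨ sum-cong-≗ (λ w → distrib σ (φ w) (δ u w) (δ v w)) ⟩
      sum (λ w → φ w ℤ.* (σ ℤ.* (δ u w ℤ.- δ v w))) ∎
      where σ = sign x

  edgeSlack : Assignment G → VertexSet G → Edge → ℕ
  edgeSlack f C e = slackAcross C (f e) (endpoints e)

  capacity≡net+slack : ∀ {s t} f C → IsFlow G s t f → IsCut G s t C →
    + capacity G C ≡ net f s ℤ.+ + sumℕ (edgeSlack f C)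
  capacity≡net+slack {s} {t} f C flow (s∈C , t∉C) = begin
    + capacity G C
      ≡⟨ ∣tabulate∣ (crosses C) ⟩
    sum (ι ∘ crosses C)
      ≡⟨ sum-cong-≗ (λ e → xor≡drop+slack (f e) _ _) ⟩
    sum (λ e → drop χ (f e) (endpoints e) ℤ.+ + edgeSlack f C e)
      ≡⟨ ∑-distrib-+ (λ e → drop χ (f e) (endpoints e)) (+_ ∘ edgeSlack f C) ⟩
    sum (λ e → drop χ (f e) (endpoints e)) ℤ.+ sum (+_ ∘ edgeSlack f C)
      ≡⟨ cong₂ ℤ._+_ (∑-drop χ f) (sym (+-sumℕ (edgeSlack f C))) ⟩
    sum (λ w → χ w ℤ.* net f w) ℤ.+ S
      -- Of the sum over all vertices only the term at `s` survives.
      ≡⟨ cong (ℤ._+ S) (sum-single ℤ.+-0-commutativeMonoid _ s conserved) ⟩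
    χ s ℤ.* net f s ℤ.+ S
      ≡⟨ cong (λ b → ι b ℤ.* net f s ℤ.+ S) ([]=⇒lookup s∈C) ⟩
    1ℤ ℤ.* net f s ℤ.+ S
      ≡⟨ cong (ℤ._+ S) (ℤ.*-identityˡ (net f s)) ⟩
    net f s ℤ.+ S ∎
    where
    open ≡-Reasoning
    χ : Vertex → ℤ
    χ w = ι (lookup C w)
    S = + sumℕ (edgeSlack f C)
    conserved : ∀ w → w ≢ s → χ w ℤ.* net f w ≡ 0ℤ
    conserved w w≢s with w ≟ t
    -- Conservation says nothing at the sink, but `χ` vanishes there because `t` lies outside the
    -- cut.
    ... | yes refl rewrite ∉⇒lookup C t∉C = ℤ.*-zeroˡ (net f w)
    ... | no w≢t = trans (cong (χ w ℤ.*_) (flow⇒net≡0 f flow w w≢s w≢t)) (ℤ.*-zeroʳ (χ w))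

  -- Reachability in the residual graph

  Inside : VertexSet G → Edge → Set
  Inside R e = proj₁ (endpoints e) ∈ R × proj₂ (endpoints e) ∈ R

  -- Every vertex v of R can receive one extra unit from s by rerouting f inside
  -- R only.  As rerouted edges stay inside R, an edge leaving R is untouched, so
  -- the set can be enlarged along it without keeping track of simple paths.
  Reachable : Assignment G → Vertex → VertexSet G → Set
  Reachable f s R = ∀ v → v ∈ R → ∃ λ g →
    (∀ w → net g w ≡ net f w ℤ.+ (δ s w ℤ.- δ v w)) ×
    (∀ e → ¬ Inside R e → g e ≡ f e)

  reachable-source : ∀ f s → Reachable f s ⁅ s ⁆
  reachable-source f s v v∈ with refl ← x∈⁅y⁆⇒x≡y s v∈ =
    f , (λ w → unchanged (net f w) (δ s w)) , λ _ _ → refl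
    where
    unchanged : ∀ a b → a ≡ a ℤ.+ (b ℤ.- b)
    unchanged = solve-∀

  net-updateAt : ∀ (g : Assignment G) e {x} w c →
    drop (λ a → δ a w) x (endpoints e) ≡ drop (λ a → δ a w) (g e) (endpoints e) ℤ.+ c →
    net (updateAt g e (const x)) w ≡ net g w ℤ.+ c
  net-updateAt g e {x} w c eq = sum-bump ℤ.+-0-commutativeMonoid _ _ e
    (trans (cong (λ y → drop (λ a → δ a w) y (endpoints e)) (updateAt-updates e g)) eq)
    (λ e′ e′≢e → cong (λ y → drop (λ a → δ a w) y (endpoints e′)) (updateAt-minimal e′ e g e′≢e))

  -- An edge with slack offers a residual step from some `u` in `R` to a `v` outside. Sending a unit
  -- from `s` to `u` and then over that edge serves `v`, while the vertices of `R` keep their old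
  -- reroutings.
  reachable-extend : ∀ f s R → Reachable f s R → ∀ e → edgeSlack f R e ≢ 0 →
    ∃ λ v → v ∉ R × Reachable f s (R ∪ ⁅ v ⁆)
  reachable-extend f s R reach e slack≢0
    with x , u , v , u∈R , v∉R , ends , push ← residual R (f e) (endpoints e) slack≢0
    = v , v∉R , reach′
    where
    R′ = R ∪ ⁅ v ⁆

    R⊆R′ : ∀ {w} → w ∈ R → w ∈ R′
    R⊆R′ = p⊆p∪q ⁅ v ⁆

    v∈R′ : v ∈ R′
    v∈R′ = q⊆p∪q R ⁅ v ⁆ (x∈⁅x⁆ v)

    leavesR : ∀ {p} → p ≡ (u , v) ⊎ p ≡ (v , u) → ¬ (proj₁ p ∈ R × proj₂ p ∈ R)
    leavesR (inj₁ refl) = v∉R ∘ proj₂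
    leavesR (inj₂ refl) = v∉R ∘ proj₁

    insideR′ : ∀ {p} → p ≡ (u , v) ⊎ p ≡ (v , u) → proj₁ p ∈ R′ × proj₂ p ∈ R′
    insideR′ (inj₁ refl) = R⊆R′ u∈R , v∈R′
    insideR′ (inj₂ refl) = v∈R′ , R⊆R′ u∈R

    weaken : ∀ {e′} → ¬ Inside R′ e′ → ¬ Inside R e′
    weaken out (a , b) = out (R⊆R′ a , R⊆R′ b)

    telescope : ∀ n a b c → (n ℤ.+ (a ℤ.- b)) ℤ.+ (b ℤ.- c) ≡ n ℤ.+ (a ℤ.- c)
    telescope = solve-∀

    reach′ : Reachable f s R′
    reach′ w w∈R′ with x∈p∪q⁻ R ⁅ v ⁆ w∈R′
    ... | inj₁ w∈R = let g , net-g , g≡f = reach w w∈R in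
      g , net-g , λ e′ out → g≡f e′ (weaken out)
    ... | inj₂ w∈⁅v⁆ with refl ← x∈⁅y⁆⇒x≡y v w∈⁅v⁆ =
      let g , net-g , g≡f = reach u u∈R
          -- `e` has an endpoint outside `R`, so the rerouting `g` for `u` has not touched it and
          -- the step found for `f` is still available in `g`.
          push-g = λ z → subst
            (λ y → drop (λ a → δ a z) x (endpoints e) ≡
                   drop (λ a → δ a z) y (endpoints e) ℤ.+ (δ u z ℤ.- δ v z))
            (sym (g≡f e (leavesR ends))) (push (λ a → δ a z))
      in updateAt g e (const x) ,
         (λ z → trans (net-updateAt g e z _ (push-g z))
                (trans (cong (ℤ._+ (δ u z ℤ.- δ v z)) (net-g z))
                       (telescope (net f z) (δ s z) (δ u z) (δ v z)))) ,
         λ e′ out → trans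
           -- The newly changed edge lies inside `R′`, so an edge not inside `R′` differs from it.
           (updateAt-minimal e′ e g λ { refl → out (insideR′ ends) })
           (g≡f e′ (weaken out))

  -- Each extension adds a vertex outside `R`, and subsets of a finite vertex set cannot grow
  -- strictly forever; the process stops only when no slack is left.
  reachable-closure : ∀ f s R → Acc _⊃_ R → s ∈ R → Reachable f s R →
    ∃ λ R′ → s ∈ R′ × Reachable f s R′ × (∀ e → edgeSlack f R′ e ≡ 0)
  reachable-closure f s R (acc rec) s∈R reach
    with any? (λ e → ¬? (edgeSlack f R e ℕ.≟ 0))
  ... | no none = R , s∈R , reach ,
    λ e → decidable-stable (edgeSlack f R e ℕ.≟ 0) λ ne → none (e , ne)
  ... | yes (e , slack≢0) =
    let v , v∉R , reach′ = reachable-extend f s R reach e slack≢0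
        R⊆R′ = p⊆p∪q ⁅ v ⁆
    in reachable-closure f s (R ∪ ⁅ v ⁆)
         (rec (R⊆R′ , v , q⊆p∪q R ⁅ v ⁆ (x∈⁅x⁆ v) , v∉R)) (R⊆R′ s∈R) reach′

  -- Maximum flow equals minimum cut

  -- Otherwise the rerouting that delivers an extra unit to `t` would be a flow of larger value.
  maxFlow⇒sink-unreachable : ∀ {s t} f R → s ≢ t → IsMaxFlow G s t f →
    Reachable f s R → t ∉ R
  maxFlow⇒sink-unreachable {s} {t} f R s≢t (flow , maximal) reach t∈R =
    let g , net-g , _ = reach t t∈R
        flow-g = net≡0⇒flow g λ v v≢s v≢t →
          trans (net-g v) (cong₂ ℤ._+_ (flow⇒net≡0 f flow v v≢s v≢t)
            (cong₂ ℤ._-_ (δ-≢ (v≢s ∘ sym)) (δ-≢ (v≢t ∘ sym))))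
        -- The value grows by `δ s s` minus `δ t s`, which is 1 because `s` and `t` differ.
        net-s = trans (net-g s) (trans (cong (ℤ._+_ (net f s))
            (cong₂ ℤ._-_ (δ-refl s) (δ-≢ (s≢t ∘ sym))))
            (ℤ.+-comm (net f s) 1ℤ))
    in ℤ.<-irrefl refl (ℤ.suc[i]≤j⇒i<j
         (subst₂ ℤ._≤_ (trans (outflow⊖inflow g s) net-s) (outflow⊖inflow f s)
           (maximal g flow-g)))

  -- Slack is nonnegative, so the value is at most the capacity of `M`. Conversely, the slack-free
  -- cut `R` has capacity equal to the value, and `M` is no larger than `R`.
  maxFlow-minCut : ∀ {s t} f M → IsMaxFlow G s t f → IsMinCut G s t M →
    net f s ≡ + capacity G M
  maxFlow-minCut {s} {t} f M maxFlow@(flow , _) (M-cut@(s∈M , t∉M) , minimal) =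
    let R , s∈R , reach , full = reachable-closure f s ⁅ s ⁆ (⊃-wellFounded _) (x∈⁅x⁆ s) (reachable-source f s)
        R-cut = s∈R , maxFlow⇒sink-unreachable f R (λ { refl → t∉M s∈M }) maxFlow reach
        R-capacity = trans (capacity≡net+slack f R flow R-cut)
          (trans (cong (λ n → net f s ℤ.+ + n) (sumℕ-zero _ full)) (ℤ.+-identityʳ (net f s)))
    in ℤ.≤-antisym
      (subst (net f s ℤ.≤_) (sym (capacity≡net+slack f M flow M-cut))
        (ℤ.i≤i+j (net f s) (+ sumℕ (edgeSlack f M))))
      (subst (+ capacity G M ℤ.≤_) R-capacity (ℤ.+≤+ (minimal R R-cut)))

  -- Cuts with total slack one

  totalSlack≡1⇔ : ∀ f C → (sumℕ (edgeSlack f C) ≡ 1) ⇔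
    (∃! _≡_ λ e →
      e ∈ E G C ×
      amount (f e) ≡ 0 ×
      (∀ e′ → e′ ∈ E G C → e′ ≢ e → amount (f e′) ≡ 1 × CarriesOutOf G f C e′))
  totalSlack≡1⇔ f C = mk⇔ to from
    where
    to : sumℕ (edgeSlack f C) ≡ 1 → _
    to eq =
      let e , slack≡1 , others = sumℕ≡1⇒single _ eq
          e-crosses , e-idle = slack≡1⇒idle (f e) _ _ slack≡1
          saturated = λ e′ e′∈E e′≢e →
            slack≡0⇒carriesOut C (f e′) (endpoints e′) (∈E⇒crosses C e′ e′∈E) (others e′ e′≢e)
      in e , (crosses⇒∈E C e e-crosses , e-idle , saturated) ,
         -- A second idle edge in the cut would be among the saturated ones, and its amount would be
         -- both 0 and 1.
         λ {e′} (e′∈E , e′-idle , _) → decidable-stable (e ≟ e′) λ e≢e′ →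
           ℕ.0≢1+n (trans (sym e′-idle) (proj₁ (saturated e′ e′∈E (e≢e′ ∘ sym))))
    from : _ → sumℕ (edgeSlack f C) ≡ 1
    from (e , (e∈E , e-idle , saturated) , _) = trans
      (sum-single ℕ.+-0-commutativeMonoid _ e others)
      (idle⇒slack≡1 (f e) _ _ (∈E⇒crosses C e e∈E) e-idle)
      where
      others : ∀ e′ → e′ ≢ e → edgeSlack f C e′ ≡ 0
      others e′ e′≢e with crosses C e′ in eq
      -- Edges that do not cross the cut have no slack, whatever they carry; the hypothesis covers
      -- the crossing ones.
      ... | false = ¬xor⇒slack≡0 (f e′) _ _ eq
      ... | true  =
        let _ , u , v , arc≡ , u∈C , v∉C = saturated e′ (crosses⇒∈E C e′ eq) e′≢e
        in carriesOut⇒slack≡0 C (f e′) (endpoints e′) arc≡ u∈C v∉C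

theorem9 : (G : Multigraph) (s t : Multigraph.Vertex G) (k : ℕ) →
    (∃ λ M → IsMinCut G s t M × capacity G M ≡ k) →
    (f : Assignment G) → IsMaxFlow G s t f →
    (C : VertexSet G) → IsCut G s t C →
    (capacity G C ≡ k + 1) ⇔
    (∃! _≡_ λ e →
    e ∈ E G C ×
    amount (f e) ≡ 0 ×
    (∀ e′ → e′ ∈ E G C → e′ ≢ e →
    amount (f e′) ≡ 1 × CarriesOutOf G f C e′))
theorem9 G s t k (M , minCut , refl) f maxFlow C C-cut = mk⇔
  (λ eq → to (ℕ.+-cancelˡ-≡ k _ _ (trans (sym capacity≡) eq)))
  (λ unique → trans capacity≡ (cong (_+_ k) (from unique)))
  where
  open Equivalence (totalSlack≡1⇔ G f C)
  capacity≡ : capacity G C ≡ k + sumℕ (edgeSlack G f C)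
  -- The identity is obtained in `ℤ`, where the flow value lives. That value is the mincut capacity,
  -- so both sides are naturals and the equation descends to `ℕ`.
  capacity≡ = ℤ.+-injective (trans (capacity≡net+slack G f C (proj₁ maxFlow) C-cut)
    (cong (ℤ._+ _) (maxFlow-minCut G f M maxFlow minCut)))
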